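{- Let $m\ge 1$ and consider the labeled chip-firing process on $\mathbb{Z}$ starting with $2m$ chips labeled $-m,\dots,-1,1,\dots,m$ at site $0$. When the process terminates (i.e. a configuration is reached in which no firing move is possible), each chip $k$ is at position $k$, regardless of the choices of firing moves made.
   Context: Labeled chip-firing on the infinite path graph $\mathbb{Z}$ (each integer $i$ adjacent to $i-1$ and $i+1$): a firing move consists of choosing two chips with labels $a<b$ located at a common site $i$, and moving chip $a$ to site $i-1$ and chip $b$ to site $i+1$. The process terminates when all chips occupy distinct sites. -}

module Defs where

open import Data.Integer using (ℤ; 0ℤ; 1ℤ; _+_; _-_; _<_; ∣_∣; NonZero)
import Data.Nat as ℕ
open import Data.Nat using (ℕ)
open import Data.Product using (∃)
open import Relation.Binary.Construct.Closure.ReflexiveTransitive using (Star)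
open import Relation.Binary.PropositionalEquality using (_≡_; _≢_)
open import Relation.Nullary using (¬_)

-- The chips are the labels -m, …, -1, 1, …, m.  The constraints are irrelevant
-- so that two chips with the same label are equal.
record Chip (m : ℕ) : Set where
  constructor chip
  field
    label    : ℤ
    .nonZero : NonZero label
    .bounded : ∣ label ∣ ℕ.≤ m

open Chip public

Config : ℕ → Set
Config m = Chip m → ℤ

initial : ∀ m → Config m
initial m _ = 0ℤ

-- C′ is only specified pointwise, so that no function extensionality is needed
-- to identify the outcome of a move.
record _⟶_ {m : ℕ} (C C′ : Config m) : Set where
  field
    site        : ℤ
    a b         : Chip m
    a<b         : label a < label b
    a-at-site   : C a ≡ site
    b-at-site   : C b ≡ site
    a-moves     : C′ a ≡ site - 1ℤ
    b-moves     : C′ b ≡ site + 1ℤ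
    others-stay : ∀ c → c ≢ a → c ≢ b → C′ c ≡ C c

infix 4 _⟶_ _⟶*_

_⟶*_ : ∀ {m} → Config m → Config m → Set
_⟶*_ = Star _⟶_

Terminal : ∀ {m} → Config m → Set
Terminal C = ¬ ∃ λ C′ → C ⟶ C′

{-# OPTIONS --safe #-}
module Submission where

-- Let v i be the number of firings still to come at i, plus max(i, 0), for i in [−m, m], and extend
-- v quadratically beyond, so that every site i of ℤ holds 1 + 2 v(i) − v(i−1) − v(i+1) chips;
-- firing at p lowers v p by 1.  Put L i = min(v i, m + min(i, 0)).  Throughout the process
-- L i ≤ L (i+1) ≤ L i + 1, and every chip k sits at a site p with k ≤ L p.  Indeed L changes in a
-- firing at p only when v p ≤ m + min(p, 0); then, as p holds at least 2 chips, the inequalities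
-- between v and L force v (p+1) = v p, v (p−1) = v p − 1 and exactly 2 chips at p.  So no resting
-- chip is affected, while of the two moving chips the larger goes where L is at least L p, and the
-- smaller goes where L is at least L p − 1.  At the end every site holds at most one chip, so v is
-- convex, whence v ≤ max(i, 0) on [−m, m] and k ≤ C k for every chip k > 0.  As no chip ever passes
-- m, downward induction on k gives C k = k.  Negative labels follow by reflection.

open import Data.Empty using (⊥-elim-irr)
open import Data.Fin using (Fin; toℕ; fromℕ<)
open import Data.Fin.Properties using (toℕ<n; toℕ-injective; toℕ-fromℕ<)
open import Data.Integer using (ℤ; +_; -[1+_]; +[1+_]; 0ℤ; 1ℤ; _+_; _-_; -_; _*_; _⊓_; _≤_; _<_; ∣_∣; +≤+; -≤+; +<+; _≟_; _≤?_)
open import Data.Integer.Properties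
open import Data.Integer.Tactic.RingSolver using (solve-∀)
open import Data.List using (List; []; _∷_; _++_; map; foldr; allFin; length)
open import Data.List.Properties using (map-cong-local; length-map; length-++; length-tabulate)
open import Data.List.Membership.Propositional using (_∈_)
open import Data.List.Membership.Propositional.Properties using (∈-∃++; ∈-map⁺; ∈-map⁻; ∈-allFin; ∈-++⁺ˡ; ∈-++⁺ʳ)
open import Data.List.Relation.Binary.Disjoint.Propositional using (Disjoint)
open import Data.List.Relation.Binary.Permutation.Propositional using (_↭_; ↭-refl; ↭-trans; prep; ↭⇒↭ₛ)
open import Data.List.Relation.Binary.Permutation.Propositional.Properties using (shift; ∈-resp-↭; map⁺)
import Data.List.Relation.Binary.Permutation.Setoid.Properties as Permutation
open import Data.List.Relation.Binary.Subset.Propositional using (_⊆_)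
open import Data.List.Relation.Unary.All as All using (All; []; _∷_)
open import Data.List.Relation.Unary.AllPairs using ([]; _∷_)
open import Data.List.Relation.Unary.Any using (here; there)
open import Data.List.Relation.Unary.Unique.Propositional using (Unique)
import Data.List.Relation.Unary.Unique.Propositional.Properties as Unique
import Data.Nat as ℕ
import Data.Nat.Properties as ℕ
open import Data.Nat using (ℕ; zero; suc)
open import Data.Product using (∃; _,_; proj₂)
open import Data.Sum using (_⊎_; inj₁; inj₂; [_,_]′)
open import Function using (_∘_; id)
open import Relation.Binary.Definitions using (tri<; tri≈; tri>)
open import Relation.Binary.Construct.Closure.ReflexiveTransitive using (ε; _◅_; gmap)
open import Relation.Binary.PropositionalEquality using (_≡_; _≢_; refl; sym; trans; cong; cong₂; subst; subst₂; setoid; ≢-sym; module ≡-Reasoning)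
open import Relation.Nullary using (Dec; yes; no; contradiction; recompute)
open import Relation.Nullary.Decidable using (map′; ⌊_⌋)
open import Data.Bool using (if_then_else_)
open import Defs

-- Inequalities between integers

≤-from : ∀ {i j k l} → i ≤ j → l - k ≡ j - i → k ≤ l
≤-from i≤j eq = 0≤i-j⇒j≤i (subst (0ℤ ≤_) (sym eq) (i≤j⇒0≤j-i i≤j))

-- Linear arithmetic by certificate: once the slack of the goal is written as the sum of the slacks
-- of the hypotheses, only a ring identity is left, which `solve-∀` proves. `≤-from` is the case of
-- one hypothesis.
≤-from₂ : ∀ {i j i′ j′ k l} → i ≤ j → i′ ≤ j′ → l - k ≡ (j - i) + (j′ - i′) → k ≤ l
≤-from₂ i≤j i′≤j′ eq =
  0≤i-j⇒j≤i (subst (0ℤ ≤_) (sym eq) (+-mono-≤ (i≤j⇒0≤j-i i≤j) (i≤j⇒0≤j-i i′≤j′)))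

<⇒+1≤ : ∀ {i j} → i < j → i + 1ℤ ≤ j
<⇒+1≤ {i} i<j = subst (_≤ _) (+-comm 1ℤ i) (i<j⇒suc[i]≤j i<j)

i-1+1≡i : ∀ i → i - 1ℤ + 1ℤ ≡ i
i-1+1≡i = solve-∀

i+1-1≡i : ∀ i → i + 1ℤ - 1ℤ ≡ i
i+1-1≡i = solve-∀

i-[j-1] : ∀ i j → i - (j - 1ℤ) ≡ i - j + 1ℤ
i-[j-1] = solve-∀

i-[j+1] : ∀ i j → i - (j + 1ℤ) ≡ i - j - 1ℤ
i-[j+1] = solve-∀

i<i+1 : ∀ i → i < i + 1ℤ
i<i+1 i = suc[i]≤j⇒i<j (≤-reflexive (+-comm 1ℤ i))

i+1≢i : ∀ i → i + 1ℤ ≢ i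
i+1≢i i = ≢-sym (<⇒≢ (i<i+1 i))

i-1≢i : ∀ i → i - 1ℤ ≢ i
i-1≢i i eq = i+1≢i (i - 1ℤ) (trans (i-1+1≡i i) (sym eq))

+1-cancel-≤ : ∀ {i j} → i + 1ℤ ≤ j + 1ℤ → i ≤ j
+1-cancel-≤ {i} {j} i+1≤j+1 = ≤-from i+1≤j+1 (rearrange i j)
  where
  rearrange : ∀ i j → j - i ≡ j + 1ℤ - (i + 1ℤ)
  rearrange = solve-∀

-- Indicators and sums over lists

δ : ℤ → ℤ → ℤ
δ i j = if ⌊ i ≟ j ⌋ then 1ℤ else 0ℤ

δ-≡ : ∀ {i j} → i ≡ j → δ i j ≡ 1ℤ
δ-≡ {i} {j} i≡j with i ≟ j
... | yes _  = refl
... | no i≢j = contradiction i≡j i≢j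

δ-≢ : ∀ {i j} → i ≢ j → δ i j ≡ 0ℤ
δ-≢ {i} {j} i≢j with i ≟ j
... | yes i≡j = contradiction i≡j i≢j
... | no _    = refl

δ-nonneg : ∀ i j → 0ℤ ≤ δ i j
δ-nonneg i j with i ≟ j
... | yes _ = +≤+ ℕ.z≤n
... | no _  = ≤-refl

δ-cong : ∀ {i j k l} → (i ≡ j → k ≡ l) → (k ≡ l → i ≡ j) → δ i j ≡ δ k l
δ-cong {i} {j} to from with i ≟ j
... | yes i≡j = sym (δ-≡ (to i≡j))
... | no i≢j  = sym (δ-≢ (i≢j ∘ from))

module _ {A : Set} where

  sumOver : List A → (A → ℤ) → ℤ
  sumOver xs f = foldr _+_ 0ℤ (map f xs)

  sumOver-cong : ∀ {f g} {xs} → All (λ x → f x ≡ g x) xs → sumOver xs f ≡ sumOver xs g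
  sumOver-cong = cong (foldr _+_ 0ℤ) ∘ map-cong-local

  sumOver-↭ : ∀ f {xs ys} → xs ↭ ys → sumOver xs f ≡ sumOver ys f
  sumOver-↭ f xs↭ys =
    Permutation.foldr-commMonoid (setoid ℤ) +-0-isCommutativeMonoid (↭⇒↭ₛ (map⁺ f xs↭ys))

  sumOver-nonneg : ∀ {f} → (∀ x → 0ℤ ≤ f x) → ∀ xs → 0ℤ ≤ sumOver xs f
  sumOver-nonneg 0≤f []       = ≤-refl
  sumOver-nonneg 0≤f (x ∷ xs) = +-mono-≤ (0≤f x) (sumOver-nonneg 0≤f xs)

  sumOver-const : ∀ k xs → sumOver xs (λ _ → k) ≡ + length xs * k
  sumOver-const k []       = refl
  sumOver-const k (x ∷ xs) =
    trans (cong (_+_ k) (sumOver-const k xs)) (sym (suc-* (+ length xs) k))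

  Unique-resp-↭ : ∀ {xs ys : List A} → xs ↭ ys → Unique xs → Unique ys
  Unique-resp-↭ = Permutation.Unique-resp-↭ (setoid A) ∘ ↭⇒↭ₛ

  ∈-tail : ∀ {x y : A} {xs} → y ≢ x → y ∈ x ∷ xs → y ∈ xs
  ∈-tail y≢x (here y≡x)   = contradiction y≡x y≢x
  ∈-tail y≢x (there y∈xs) = y∈xs

  -- Used to split a sum over all chips into the few chips of interest and the rest.
  extract : ∀ {xs ys : List A} → Unique xs → xs ⊆ ys → ∃ λ zs → ys ↭ xs ++ zs
  extract {[]}     {ys} _ _ = ys , ↭-refl
  extract {x ∷ xs} (x∉xs ∷ uniq) xs⊆ys
    with us , vs , refl ← ∈-∃++ (xs⊆ys (here refl))
    with zs , perm ← extract uniq (λ z∈xs →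
           ∈-tail (≢-sym (All.lookup x∉xs z∈xs)) (∈-resp-↭ (shift x us vs) (xs⊆ys (there z∈xs))))
    = zs , ↭-trans (shift x us vs) (prep x perm)

-- Chips

chip-≡ : ∀ {m} {a b : Chip m} → label a ≡ label b → a ≡ b
chip-≡ {a = chip _ _ _} {chip _ _ _} refl = refl

_≟ᶜ_ : ∀ {m} (a b : Chip m) → Dec (a ≡ b)
a ≟ᶜ b = map′ chip-≡ (cong label) (label a ≟ label b)

label≤m : ∀ {m} (k : Chip m) → label k ≤ + m
-- The bound is an irrelevant field; decidability of `ℕ.≤` lets `recompute` recover a usable proof.
label≤m {m} (chip +[1+ n ] _ bd) = +≤+ (recompute (suc n ℕ.≤? m) bd)
label≤m (chip (+ zero) _ _) = +≤+ ℕ.z≤n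
label≤m (chip -[1+ n ] _ _) = -≤+

module _ (m : ℕ) where

  positive negative : Fin m → Chip m
  positive i = chip +[1+ toℕ i ] _ (toℕ<n i)
  negative i = chip -[1+ toℕ i ] _ (toℕ<n i)

  chips : List (Chip m)
  chips = map positive (allFin m) ++ map negative (allFin m)

  chips-unique : Unique chips
  chips-unique = Unique.++⁺
    (Unique.map⁺ (λ {i} {j} eq → toℕ-injective (+[1+-injective (cong label {positive i} {positive j} eq))) (Unique.allFin⁺ m))
    (Unique.map⁺ (λ {i} {j} eq → toℕ-injective (-[1+-injective (cong label {negative i} {negative j} eq))) (Unique.allFin⁺ m))
    disjoint
    where
    disjoint : Disjoint (map positive (allFin m)) (map negative (allFin m))
    disjoint (p , q) with ∈-map⁻ positive p | ∈-map⁻ negative q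
    ... | _ , _ , refl | _ , _ , ()

  ∈-chips : ∀ c → c ∈ chips
  ∈-chips (chip +[1+ n ] _ bd) =
    subst (_∈ chips) (chip-≡ (cong +[1+_] (toℕ-fromℕ< n<m)))
      (∈-++⁺ˡ (∈-map⁺ positive (∈-allFin (fromℕ< n<m))))
    where n<m = recompute (suc n ℕ.≤? m) bd
  ∈-chips (chip -[1+ n ] _ bd) =
    subst (_∈ chips) (chip-≡ (cong -[1+_] (toℕ-fromℕ< n<m)))
      (∈-++⁺ʳ _ (∈-map⁺ negative (∈-allFin (fromℕ< n<m))))
    where n<m = recompute (suc n ℕ.≤? m) bd

  length-chips : length chips ≡ m ℕ.+ m
  length-chips = begin
    length chips
      ≡⟨ length-++ (map positive (allFin m)) ⟩
    length (map positive (allFin m)) ℕ.+ length (map negative (allFin m))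
      ≡⟨ cong₂ ℕ._+_ (length-map positive (allFin m)) (length-map negative (allFin m)) ⟩
    length (allFin m) ℕ.+ length (allFin m)
      ≡⟨ cong₂ ℕ._+_ (length-tabulate {n = m} id) (length-tabulate {n = m} id) ⟩
    m ℕ.+ m ∎
    where
    open ≡-Reasoning

-- Number of chips at a site

module _ {m : ℕ} where

  occupancy : Config m → ℤ → ℤ
  occupancy C i = sumOver (chips m) (λ c → δ (C c) i)

  private
    split : ∀ {xs} → Unique xs → ∃ λ zs → chips m ↭ xs ++ zs
    split uniq = extract uniq (λ {c} _ → ∈-chips m c)

  occupancy≥2 : ∀ {C i} {a b : Chip m} → a ≢ b → C a ≡ i → C b ≡ i → + 2 ≤ occupancy C i
  occupancy≥2 {C} {i} a≢b Ca Cb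
    with zs , perm ← split ((a≢b ∷ []) ∷ [] ∷ [])
    rewrite sumOver-↭ (λ c → δ (C c) i) perm | δ-≡ Ca | δ-≡ Cb
    = +-monoʳ-≤ 1ℤ (+-monoʳ-≤ 1ℤ (sumOver-nonneg (λ c → δ-nonneg (C c) i) zs))

  occupancy≥3 : ∀ {C i} {a b c : Chip m} → a ≢ b → a ≢ c → b ≢ c →
                C a ≡ i → C b ≡ i → C c ≡ i → + 3 ≤ occupancy C i
  occupancy≥3 {C} {i} a≢b a≢c b≢c Ca Cb Cc
    with zs , perm ← split ((a≢b ∷ a≢c ∷ []) ∷ (b≢c ∷ []) ∷ [] ∷ [])
    rewrite sumOver-↭ (λ c → δ (C c) i) perm | δ-≡ Ca | δ-≡ Cb | δ-≡ Cc
    = +-monoʳ-≤ 1ℤ (+-monoʳ-≤ 1ℤ (+-monoʳ-≤ 1ℤ (sumOver-nonneg (λ c → δ-nonneg (C c) i) zs)))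

  occupancy≤1 : ∀ {C} → (∀ a b → C a ≡ C b → a ≡ b) → ∀ i → occupancy C i ≤ 1ℤ
  occupancy≤1 {C} inj i = go (chips-unique m)
    where
    go : ∀ {xs} → Unique xs → sumOver xs (λ c → δ (C c) i) ≤ 1ℤ
    go [] = +≤+ ℕ.z≤n
    go {x ∷ xs} (x∉xs ∷ uniq) with C x ≟ i
    ... | no _     = subst (_≤ 1ℤ) (sym (+-identityˡ _)) (go uniq)
    ... | yes refl = ≤-reflexive (cong (_+_ 1ℤ) (trans
                       (sumOver-cong (All.map (λ {y} x≢y → δ-≢ (x≢y ∘ sym ∘ inj y x)) x∉xs))
                       (trans (sumOver-const 0ℤ xs) (*-zeroʳ (+ length xs)))))

  occupancy-initial : ∀ i → occupancy (initial m) i ≡ (+ m + + m) * δ 0ℤ i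
  occupancy-initial i =
    trans (sumOver-const (δ 0ℤ i) (chips m)) (cong (λ n → + n * δ 0ℤ i) (length-chips m))

  module _ {C C′ : Config m} (s : C ⟶ C′) where
    open _⟶_ s

    a≢b : a ≢ b
    a≢b eq = <⇒≢ a<b (cong label eq)

    -- `δ site (i + 1ℤ)` counts the arrival of `a` at `site - 1ℤ`, and `δ site (i - 1ℤ)` that of `b`
    -- at `site + 1ℤ`. In this form the change is the discrete Laplacian of `δ site`, ready to be
    -- absorbed by lowering the potential at `site`.
    occupancy-step : ∀ i →
      occupancy C′ i ≡ occupancy C i - (δ site i + δ site i) + δ site (i + 1ℤ) + δ site (i - 1ℤ)
    occupancy-step i
      with zs , perm ← split ((a≢b ∷ []) ∷ [] ∷ [])
      with (_ ∷ a∉zs) ∷ b∉zs ∷ _ ← Unique-resp-↭ perm (chips-unique m)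
      = begin
        occupancy C′ i
          ≡⟨ sumOver-↭ (λ c → δ (C′ c) i) perm ⟩
        δ (C′ a) i + (δ (C′ b) i + sumOver zs (λ c → δ (C′ c) i))
          ≡⟨ cong₂ _+_ δa (cong₂ _+_ δb (sumOver-cong (All.zipWith (λ {c} (a≢c , b≢c) →
               cong (λ p → δ p i) (others-stay c (≢-sym a≢c) (≢-sym b≢c))) (a∉zs , b∉zs)))) ⟩
        δ site (i + 1ℤ) + (δ site (i - 1ℤ) + rest)
          ≡⟨ rearrange (δ site i) _ _ rest ⟩
        (δ site i + (δ site i + rest)) - (δ site i + δ site i) + δ site (i + 1ℤ) + δ site (i - 1ℤ)
          ≡⟨ cong (λ n → n - (δ site i + δ site i) + δ site (i + 1ℤ) + δ site (i - 1ℤ))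
               (sym (trans (sumOver-↭ (λ c → δ (C c) i) perm)
                  (cong₂ (λ p q → δ p i + (δ q i + rest)) a-at-site b-at-site))) ⟩
        occupancy C i - (δ site i + δ site i) + δ site (i + 1ℤ) + δ site (i - 1ℤ) ∎
      where
      open ≡-Reasoning
      rest = sumOver zs (λ c → δ (C c) i)
      rearrange : ∀ d l r z → l + (r + z) ≡ (d + (d + z)) - (d + d) + l + r
      rearrange = solve-∀
      δa : δ (C′ a) i ≡ δ site (i + 1ℤ)
      δa = δ-cong
        (λ eq → trans (sym (i-1+1≡i site)) (cong (_+ 1ℤ) (trans (sym a-moves) eq)))
        (λ eq → trans a-moves (trans (cong (_- 1ℤ) eq) (i+1-1≡i i)))
      δb : δ (C′ b) i ≡ δ site (i - 1ℤ)
      δb = δ-cong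
        (λ eq → trans (sym (i+1-1≡i site)) (cong (_- 1ℤ) (trans (sym b-moves) eq)))
        (λ eq → trans b-moves (trans (cong (_+ 1ℤ) eq) (i-1+1≡i i)))

-- Terminal configurations

module _ {m : ℕ} where

  -- The form in which termination is used: free of moves, it passes directly to the reflected
  -- configuration.
  Sparse : Config m → Set
  Sparse C = ∀ a b → label a < label b → C a ≢ C b

  sparse⇒injective : ∀ {C} → Sparse C → ∀ a b → C a ≡ C b → a ≡ b
  sparse⇒injective sparse a b Ca≡Cb with <-cmp (label a) (label b)
  ... | tri< a<b _ _ = contradiction Ca≡Cb (sparse a b a<b)
  ... | tri≈ _ a≡b _ = chip-≡ a≡b
  ... | tri> _ _ b<a = contradiction (sym Ca≡Cb) (sparse b a b<a)

  terminal⇒sparse : ∀ {C} → Terminal C → Sparse C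
  terminal⇒sparse {C} terminal a b a<b Ca≡Cb = terminal (C′ , record
    { site        = C a
    ; a           = a
    ; b           = b
    ; a<b         = a<b
    ; a-at-site   = refl
    ; b-at-site   = sym Ca≡Cb
    ; a-moves     = a-moves
    ; b-moves     = b-moves
    ; others-stay = others-stay
    })
    where
    C′ : Config m
    C′ c with c ≟ᶜ a | c ≟ᶜ b
    ... | yes _ | _     = C a - 1ℤ
    ... | no _  | yes _ = C a + 1ℤ
    ... | no _  | no _  = C c
    a-moves : C′ a ≡ C a - 1ℤ
    a-moves with a ≟ᶜ a | a ≟ᶜ b
    ... | yes _  | _ = refl
    ... | no a≢a | _ = contradiction refl a≢a
    b-moves : C′ b ≡ C a + 1ℤ
    b-moves with b ≟ᶜ a | b ≟ᶜ b
    ... | yes b≡a | _      = contradiction (cong label (sym b≡a)) (<⇒≢ a<b)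
    ... | no _    | yes _  = refl
    ... | no _    | no b≢b = contradiction refl b≢b
    others-stay : ∀ c → c ≢ a → c ≢ b → C′ c ≡ C c
    others-stay c c≢a c≢b with c ≟ᶜ a | c ≟ᶜ b
    ... | yes c≡a | _       = contradiction c≡a c≢a
    ... | no _    | yes c≡b = contradiction c≡b c≢b
    ... | no _    | no _    = refl

-- An integral convex function lying on or below max(i, 0) at both ends of an interval
-- lies below it throughout, as each of its slopes is at most 0 or at least 1.
module Convex {v : ℤ → ℤ} (convex : ∀ i → v i + v i ≤ v (i - 1ℤ) + v (i + 1ℤ)) where

  nonincreasing-leftwards : ∀ n p → v (p + 1ℤ) ≤ v p → v p ≤ v (p - + n)
  nonincreasing-leftwards zero    p _ = ≤-reflexive (cong v (sym (+-identityʳ p)))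
  nonincreasing-leftwards (suc n) p vp+1≤vp = ≤-trans vp≤vp-1
    (subst (v (p - 1ℤ) ≤_) (cong v (shift-by p (+ n)))
      (nonincreasing-leftwards n (p - 1ℤ) (subst (_≤ v (p - 1ℤ)) (cong v (sym (i-1+1≡i p))) vp≤vp-1)))
    where
    shift-by : ∀ p n → p - 1ℤ - n ≡ p - (1ℤ + n)
    shift-by = solve-∀
    rearrange : ∀ v l r → l - v ≡ (l + r - (v + v)) + (v - r)
    rearrange = solve-∀
    vp≤vp-1 : v p ≤ v (p - 1ℤ)
    vp≤vp-1 = ≤-from₂ (convex p) vp+1≤vp (rearrange (v p) (v (p - 1ℤ)) (v (p + 1ℤ)))

  increasing-rightwards : ∀ n p → v p + 1ℤ ≤ v (p + 1ℤ) → v p + + n ≤ v (p + + n)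
  increasing-rightwards zero    p _ = ≤-reflexive (trans (+-identityʳ (v p)) (cong v (sym (+-identityʳ p))))
  increasing-rightwards (suc n) p vp<vp+1 =
    ≤-from₂ vp<vp+1
      (subst (v (p + 1ℤ) + + n ≤_) (cong v (shift-by p (+ n)))
        (increasing-rightwards n (p + 1ℤ) next))
      (rearrange₂ (v p) (v (p + 1ℤ)) (+ n) (v (p + +[1+ n ])))
    where
    shift-by : ∀ p n → p + 1ℤ + n ≡ p + (1ℤ + n)
    shift-by = solve-∀
    rearrange₁ : ∀ l v r → r - (v + 1ℤ) ≡ (l + r - (v + v)) + (v - (l + 1ℤ))
    rearrange₁ = solve-∀
    rearrange₂ : ∀ v r n w → w - (v + (1ℤ + n)) ≡ (r - (v + 1ℤ)) + (w - (r + n))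
    rearrange₂ = solve-∀
    next : v (p + 1ℤ) + 1ℤ ≤ v (p + 1ℤ + 1ℤ)
    next = ≤-from₂
      (subst (λ i → v (p + 1ℤ) + v (p + 1ℤ) ≤ v i + v (p + 1ℤ + 1ℤ)) (i+1-1≡i p) (convex (p + 1ℤ)))
      vp<vp+1 (rearrange₁ (v p) (v (p + 1ℤ)) (v (p + 1ℤ + 1ℤ)))

  -- The slope just to the right of `p` decides. If it is not positive, the value at the left end
  -- bounds `v p`; otherwise, being an integer, it is at least 1, and the value at the right end
  -- gives the bound.
  below-ramp : ∀ {i j} → v i ≤ 0ℤ → v j ≤ j → ∀ {p} → i ≤ p → p ≤ j → v p ≤ 0ℤ ⊎ v p ≤ p
  below-ramp {i} {j} vi≤0 vj≤j {p} i≤p p≤j with v (p + 1ℤ) ≤? v p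
  ... | yes vp+1≤vp = inj₁ (≤-trans
          (subst (v p ≤_) (cong v to-left) (nonincreasing-leftwards ∣ p - i ∣ p vp+1≤vp)) vi≤0)
    where
    cancel : ∀ p i → p - (p - i) ≡ i
    cancel = solve-∀
    to-left : p - + ∣ p - i ∣ ≡ i
    to-left = trans (cong (_-_ p) (0≤i⇒+∣i∣≡i (i≤j⇒0≤j-i i≤p))) (cancel p i)
  ... | no vp+1≰vp = inj₂ (≤-from₂ vj≤j
          (subst₂ (λ d q → v p + d ≤ v q) distance (trans (cong (_+_ p) distance) (cancel p j))
            (increasing-rightwards ∣ j - p ∣ p (<⇒+1≤ (≰⇒> vp+1≰vp))))
          (rearrange (v p) (v j) p j))
    where
    distance : + ∣ j - p ∣ ≡ j - p
    distance = 0≤i⇒+∣i∣≡i (i≤j⇒0≤j-i p≤j)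
    cancel : ∀ p j → p + (j - p) ≡ j
    cancel = solve-∀
    rearrange : ∀ v w p j → p - v ≡ (j - w) + (w - (v + (j - p)))
    rearrange = solve-∀

-- The initial potential

triangular : ℕ → ℤ
triangular zero    = 0ℤ
triangular (suc n) = triangular n + +[1+ n ]

-- The polynomial x(x+1)/2; its values at negative x keep the second difference 1 beyond ±m.
T : ℤ → ℤ
T (+ n)    = triangular n
T -[1+ n ] = triangular n

T-step : ∀ i → T (i + 1ℤ) ≡ T i + (i + 1ℤ)
T-step (+ n) rewrite ℕ.+-comm n 1 = refl
T-step -[1+ zero ]  = refl
T-step -[1+ suc n ] = cancel (triangular n) +[1+ n ]
  where
  cancel : ∀ t i → t ≡ t + i + - i
  cancel = solve-∀

T-nonneg : ∀ i → 0ℤ ≤ T i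
T-nonneg (+ n)    = triangular-nonneg n
  where
  triangular-nonneg : ∀ n → 0ℤ ≤ triangular n
  triangular-nonneg zero    = ≤-refl
  triangular-nonneg (suc n) = +-mono-≤ (triangular-nonneg n) (+≤+ ℕ.z≤n)
T-nonneg -[1+ n ] = T-nonneg (+ n)

T-pred : ∀ i → T (i - 1ℤ) ≡ T i - i
T-pred i = begin
  T (i - 1ℤ)                           ≡⟨ cancel (T (i - 1ℤ)) i ⟩
  T (i - 1ℤ) + (i - 1ℤ + 1ℤ) - i       ≡⟨ cong (_- i) (T-step (i - 1ℤ)) ⟨
  T (i - 1ℤ + 1ℤ) - i                  ≡⟨ cong (λ j → T j - i) (i-1+1≡i i) ⟩
  T i - i                              ∎
  where
  open ≡-Reasoning
  cancel : ∀ t i → t ≡ t + (i - 1ℤ + 1ℤ) - i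
  cancel = solve-∀

-- The difference `T i - i` is itself a value of `T`, at `i - 1ℤ`.
i≤T[i] : ∀ i → i ≤ T i
i≤T[i] i = 0≤i-j⇒j≤i (subst (0ℤ ≤_) (T-pred i) (T-nonneg (i - 1ℤ)))

-- The invariant

module _ (m : ℕ) where

  -- Zero at `- + m`, rising with slope 1 up to the origin, constant from there on; it is the level
  -- of every site at the start.
  cap : ℤ → ℤ
  cap i = + m + (i ⊓ 0ℤ)

  cap≤m : ∀ i → cap i ≤ + m
  cap≤m i = subst (cap i ≤_) (+-identityʳ (+ m)) (+-monoʳ-≤ (+ m) (i⊓j≤j i 0ℤ))

  cap-nonneg : ∀ {i} → 0ℤ ≤ i → cap i ≡ + m
  cap-nonneg 0≤i = trans (cong (_+_ (+ m)) (i≥j⇒i⊓j≡j 0≤i)) (+-identityʳ (+ m))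

  cap-mono : ∀ i → cap i ≤ cap (i + 1ℤ)
  cap-mono i = +-monoʳ-≤ (+ m) (⊓-mono-≤ (<⇒≤ (i<i+1 i)) (≤-refl {0ℤ}))

  cap-lipschitz : ∀ i → cap (i + 1ℤ) ≤ cap i + 1ℤ
  cap-lipschitz i = subst (cap (i + 1ℤ) ≤_) (sym (+-assoc (+ m) (i ⊓ 0ℤ) 1ℤ))
    (+-monoʳ-≤ (+ m) (lip (≤-total i 0ℤ)))
    where
    lip : i ≤ 0ℤ ⊎ 0ℤ ≤ i → (i + 1ℤ) ⊓ 0ℤ ≤ i ⊓ 0ℤ + 1ℤ
    lip (inj₁ i≤0) rewrite i≤j⇒i⊓j≡i i≤0 = i⊓j≤i (i + 1ℤ) 0ℤ
    lip (inj₂ 0≤i) rewrite i≥j⇒i⊓j≡j 0≤i = ≤-trans (i⊓j≤j (i + 1ℤ) 0ℤ) (+≤+ ℕ.z≤n)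

  -- For i in [-m, m] the `T` term is the total number of firings at i. The ramp added on the right
  -- accounts for the origin, the one site of this interval that ends up empty.
  potential₀ : ℤ → ℤ
  potential₀ i@(+ _)      = T (+ m - i) + i
  potential₀ i@(-[1+ _ ]) = T (+ m + i)

  potential₀-nonneg : ∀ {i} → 0ℤ ≤ i → potential₀ i ≡ T (+ m - i) + i
  potential₀-nonneg {+ _} _ = refl

  -- The two formulas agree at 0, so each half-line can include the origin; the second differences
  -- at 1 and -1 need this.
  potential₀-nonpos : ∀ {i} → i ≤ 0ℤ → potential₀ i ≡ T (+ m + i)
  potential₀-nonpos { -[1+ _ ]} _ = refl
  potential₀-nonpos {+ zero} _ = +-identityʳ (T (+ m + 0ℤ))
  potential₀-nonpos {+[1+ _ ]} (+≤+ ())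

  -- On both sides this comes down to `i≤T[i]`, applied at m + i on the left and at m - i on the
  -- right.
  cap≤potential₀ : ∀ i → cap i ≤ potential₀ i
  cap≤potential₀ i with ≤-total i 0ℤ
  ... | inj₁ i≤0 rewrite potential₀-nonpos i≤0 | i≤j⇒i⊓j≡i i≤0 = i≤T[i] (+ m + i)
  ... | inj₂ 0≤i rewrite potential₀-nonneg 0≤i =
    ≤-trans (cap≤m i) (≤-from (i≤T[i] (+ m - i)) (rearrange (T (+ m - i)) (+ m) i))
    where
    rearrange : ∀ t m i → t + i - m ≡ t - (m - i)
    rearrange = solve-∀

  -- Away from the origin, `T` has second difference 1, which cancels the constant 1. At the origin
  -- the neighbours have values T(m) - m and T(m) - m + 1, which leaves 2m.
  potential₀-laplacian : ∀ i → (+ m + + m) * δ 0ℤ i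
    ≡ 1ℤ + (potential₀ i + potential₀ i) - potential₀ (i - 1ℤ) - potential₀ (i + 1ℤ)
  potential₀-laplacian i with <-cmp i 0ℤ
  ... | tri< i<0 i≢0 _
    rewrite δ-≢ (≢-sym i≢0)
          | potential₀-nonpos (<⇒≤ i<0)
          | potential₀-nonpos (≤-trans (i-j≤i i 1ℤ) (<⇒≤ i<0))
          | potential₀-nonpos (<⇒+1≤ i<0)
          | sym (+-assoc (+ m) i 1ℤ)
          | sym (+-assoc (+ m) i (- 1ℤ))
          | T-step (+ m + i)
          | T-pred (+ m + i)
    = rearrange (T (+ m + i)) (+ m) i
    where
    rearrange : ∀ t m i → (m + m) * 0ℤ ≡
      1ℤ + (t + t) - (t - (m + i)) - (t + (m + i + 1ℤ))
    rearrange = solve-∀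
  ... | tri≈ _ refl _
    rewrite ℕ.+-identityʳ m
          | T-pred (+ m)
    = rearrange (T (+ m)) (+ m)
    where
    rearrange : ∀ t m → (m + m) * 1ℤ ≡
      1ℤ + ((t + 0ℤ) + (t + 0ℤ)) - (t - m) - (t - m + 1ℤ)
    rearrange = solve-∀
  ... | tri> _ i≢0 0<i
    rewrite δ-≢ (≢-sym i≢0)
          | potential₀-nonneg (<⇒≤ 0<i)
          | potential₀-nonneg (i≤j⇒0≤j-i (<⇒+1≤ 0<i))
          | potential₀-nonneg (≤-trans (<⇒≤ 0<i) (<⇒≤ (i<i+1 i)))
          | i-[j-1] (+ m) i
          | i-[j+1] (+ m) i
          | T-step (+ m - i)
          | T-pred (+ m - i)
    = rearrange (T (+ m - i)) (+ m) i
    where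
    rearrange : ∀ t m i → (m + m) * 0ℤ ≡
      1ℤ + ((t + i) + (t + i)) - (t + (m - i + 1ℤ) + (i - 1ℤ)) - (t - (m - i) + (i + 1ℤ))
    rearrange = solve-∀

  level : (ℤ → ℤ) → ℤ → ℤ
  level v i = v i ⊓ cap i

  level≤ : ∀ v i → level v i ≤ v i
  level≤ v i = i⊓j≤i (v i) (cap i)

  -- With the constant 1, a site holds at most one chip exactly when `v` is convex there.
  HasLaplacian : Config m → (ℤ → ℤ) → Set
  HasLaplacian C v = ∀ i → occupancy C i ≡ 1ℤ + (v i + v i) - v (i - 1ℤ) - v (i + 1ℤ)

  -- `right-end` and `beyond` fix a slope of 1 after m, which rules out firing at m and so preserves
  -- `position≤m`; `left-end` and `right-end` are the end values for the final convexity argument.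
  record Invariant (C : Config m) (v : ℤ → ℤ) : Set where
    field
      laplacian       : HasLaplacian C v
      level-mono      : ∀ i → level v i ≤ level v (i + 1ℤ)
      level-lipschitz : ∀ i → level v (i + 1ℤ) ≤ level v i + 1ℤ
      label≤level     : ∀ k → label k ≤ level v (C k)
      right-end       : v (+ m) ≡ + m
      beyond          : v (+ m + 1ℤ) ≡ + m + 1ℤ
      left-end        : v (- + m) ≤ 0ℤ
      position≤m      : ∀ k → C k ≤ + m

  invariant₀ : Invariant (initial m) potential₀
  invariant₀ = record
    { laplacian       = λ i → trans (occupancy-initial {m} i) (potential₀-laplacian i)
    ; level-mono      = λ i → subst₂ _≤_ (sym (level₀ i)) (sym (level₀ (i + 1ℤ))) (cap-mono i)
    ; level-lipschitz = λ i → subst₂ _≤_ (sym (level₀ (i + 1ℤ))) (cong (_+ 1ℤ) (sym (level₀ i))) (cap-lipschitz i)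
    ; label≤level     = λ k → subst (label k ≤_) (sym (trans (level₀ 0ℤ) (cap-nonneg ≤-refl))) (label≤m k)
    ; right-end       = cong (λ i → T i + + m) (+-inverseʳ (+ m))
    ; beyond          = trans (potential₀-nonneg (≤-trans (+≤+ ℕ.z≤n) (<⇒≤ (i<i+1 (+ m)))))
                          (trans (cong (λ i → T i + (+ m + 1ℤ)) (cancel (+ m))) (+-identityˡ (+ m + 1ℤ)))
    ; left-end        = ≤-reflexive (trans (potential₀-nonpos (neg-mono-≤ (+≤+ (ℕ.z≤n {m})))) (cong T (+-inverseʳ (+ m))))
    ; position≤m      = λ _ → +≤+ ℕ.z≤n
    }
    where
    level₀ : ∀ i → level potential₀ i ≡ cap i
    level₀ i = i≥j⇒i⊓j≡j (cap≤potential₀ i)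
    cancel : ∀ m → m - (m + 1ℤ) ≡ - 1ℤ
    cancel = solve-∀

  -- Effect of one firing on potential and level

  fire : ℤ → (ℤ → ℤ) → ℤ → ℤ
  fire p v i = v i - δ p i

  fire-at : ∀ p v → fire p v p ≡ v p - 1ℤ
  fire-at p v = cong (_-_ (v p)) (δ-≡ {p} refl)

  fire-off : ∀ {p i} v → i ≢ p → fire p v i ≡ v i
  fire-off {p} {i} v i≢p = trans (cong (_-_ (v i)) (δ-≢ (≢-sym i≢p))) (+-identityʳ (v i))

  fire≤ : ∀ p v i → fire p v i ≤ v i
  fire≤ p v i = ≤-from (δ-nonneg p i) (rearrange (v i) (δ p i))
    where
    rearrange : ∀ v d → v - (v - d) ≡ d - 0ℤ
    rearrange = solve-∀

  fire-laplacian : ∀ {C C′ : Config m} {v} (s : C ⟶ C′) →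
    HasLaplacian C v → HasLaplacian C′ (fire (_⟶_.site s) v)
  fire-laplacian {v = v} s laplacian i =
    trans (occupancy-step s i)
      (trans (cong (λ n → n - (δ site i + δ site i) + δ site (i + 1ℤ) + δ site (i - 1ℤ)) (laplacian i))
        (rearrange (v i) (v (i - 1ℤ)) (v (i + 1ℤ)) (δ site i) (δ site (i - 1ℤ)) (δ site (i + 1ℤ))))
    where
    open _⟶_ s
    rearrange : ∀ v l r d dl dr → 1ℤ + (v + v) - l - r - (d + d) + dr + dl
      ≡ 1ℤ + ((v - d) + (v - d)) - (l - dl) - (r - dr)
    rearrange = solve-∀

  record Tight (C : Config m) (v : ℤ → ℤ) (p : ℤ) : Set where
    field
      right       : v (p + 1ℤ) ≡ v p
      level-right : level v (p + 1ℤ) ≡ v p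
      level-left  : level v (p - 1ℤ) + 1ℤ ≡ v p
      occupancy≡2 : occupancy C p ≡ + 2

  -- Below the cap the level at p is `v p`, so the level inequalities give v(p) ≤ v(p+1) and v(p) ≤
  -- v(p-1) + 1. Hence p holds at most 2 chips, and holding 2 forces equality throughout.
  tight : ∀ {C v} → Invariant C v → ∀ {p} → + 2 ≤ occupancy C p → v p ≤ cap p → Tight C v p
  tight {C} {v} inv {p} 2≤occ v≤cap = record
    { right       = right
    ; level-right = ≤-antisym (subst (level v (p + 1ℤ) ≤_) right (level≤ v (p + 1ℤ))) v≤Lr
    ; level-left  = ≤-antisym (≤-trans (+-monoˡ-≤ 1ℤ (level≤ v (p - 1ℤ))) l+1≤v) v≤Ll+1
    ; occupancy≡2 = ≤-antisym occ≤2 2≤occ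
    }
    where
    open Invariant inv
    l = v (p - 1ℤ)
    r = v (p + 1ℤ)
    Lp : level v p ≡ v p
    Lp = i≤j⇒i⊓j≡i v≤cap
    v≤Lr : v p ≤ level v (p + 1ℤ)
    v≤Lr = subst (_≤ level v (p + 1ℤ)) Lp (level-mono p)
    v≤Ll+1 : v p ≤ level v (p - 1ℤ) + 1ℤ
    v≤Ll+1 = subst (_≤ level v (p - 1ℤ) + 1ℤ) (trans (cong (level v) (i-1+1≡i p)) Lp) (level-lipschitz (p - 1ℤ))
    v≤r : v p ≤ r
    v≤r = ≤-trans v≤Lr (level≤ v (p + 1ℤ))
    v≤l+1 : v p ≤ l + 1ℤ
    v≤l+1 = ≤-trans v≤Ll+1 (+-monoˡ-≤ 1ℤ (level≤ v (p - 1ℤ)))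
    2≤Δ : + 2 ≤ 1ℤ + (v p + v p) - l - r
    2≤Δ = subst (+ 2 ≤_) (laplacian p) 2≤occ
    r≤v : r ≤ v p
    r≤v = ≤-from₂ 2≤Δ v≤l+1 (rearrange (v p) l r)
      where
      rearrange : ∀ v l r → v - r ≡ (1ℤ + (v + v) - l - r - + 2) + (l + 1ℤ - v)
      rearrange = solve-∀
    l+1≤v : l + 1ℤ ≤ v p
    l+1≤v = ≤-from₂ 2≤Δ v≤r (rearrange (v p) l r)
      where
      rearrange : ∀ v l r → v - (l + 1ℤ) ≡ (1ℤ + (v + v) - l - r - + 2) + (r - v)
      rearrange = solve-∀
    occ≤2 : occupancy C p ≤ + 2
    occ≤2 = subst (_≤ + 2) (sym (laplacian p)) (≤-from₂ v≤l+1 v≤r (rearrange (v p) l r))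
      where
      rearrange : ∀ v l r → + 2 - (1ℤ + (v + v) - l - r) ≡ (l + 1ℤ - v) + (r - v)
      rearrange = solve-∀
    right : r ≡ v p
    right = ≤-antisym r≤v v≤r

  data Effect (C : Config m) (v : ℤ → ℤ) (p : ℤ) : Set where
    unchanged : level (fire p v) p ≡ level v p → Effect C v p
    lowered   : Tight C v p → level (fire p v) p ≡ v p - 1ℤ → Effect C v p

  effect : ∀ {C v} → Invariant C v → ∀ {p} → + 2 ≤ occupancy C p → Effect C v p
  effect {v = v} inv {p} 2≤occ with v p ≤? cap p
  ... | yes v≤cap = lowered (tight inv 2≤occ v≤cap)
          (trans (cong (_⊓ cap p) (fire-at p v))
                 (i≤j⇒i⊓j≡i (≤-trans (i-j≤i (v p) 1ℤ) v≤cap)))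
  -- `v p` exceeds the cap by at least 1, so the level equals the cap both before and after the
  -- firing.
  ... | no v≰cap  = unchanged (trans
          (i≥j⇒i⊓j≡j (subst (cap p ≤_) (sym (fire-at p v)) (≤-from (<⇒+1≤ (≰⇒> v≰cap)) (rearrange (v p) (cap p)))))
          (sym (i≥j⇒i⊓j≡j (<⇒≤ (≰⇒> v≰cap)))))
    where
    rearrange : ∀ v c → v - 1ℤ - c ≡ v - (c + 1ℤ)
    rearrange = solve-∀

  -- Preservation of the invariant

  module Step {C C′ : Config m} {v : ℤ → ℤ} (inv : Invariant C v) (s : C ⟶ C′) where
    open Invariant inv
    open _⟶_ s

    v′ : ℤ → ℤ
    v′ = fire site v

    2≤occupancy : + 2 ≤ occupancy C site
    2≤occupancy = occupancy≥2 (a≢b s) a-at-site b-at-site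

    level-off : ∀ {i} → i ≢ site → level v′ i ≡ level v i
    level-off {i} i≢site = cong (_⊓ cap i) (fire-off v i≢site)

    level-same : level v′ site ≡ level v site → ∀ i → level v′ i ≡ level v i
    level-same eq i with i ≟ site
    ... | yes refl  = eq
    ... | no i≢site = level-off i≢site

    -- Only the two level slopes at the fired site can change. If its level drops, `Tight` says that
    -- the left slope goes from 1 to 0 and the right slope from 0 to 1. The same holds the key to
    -- `level-lipschitz′`.
    level-mono′ : ∀ i → level v′ i ≤ level v′ (i + 1ℤ)
    level-mono′ i with effect inv 2≤occupancy
    ... | unchanged eq
        = subst₂ _≤_ (sym (level-same eq i)) (sym (level-same eq (i + 1ℤ))) (level-mono i)
    ... | lowered t eq with i ≟ site | i + 1ℤ ≟ site
    ...   | yes refl | _ = subst₂ _≤_ (sym eq) (sym (trans (level-off (i+1≢i i)) level-right)) (i-j≤i (v i) 1ℤ)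
      where
      open Tight t
    ...   | no i≢ | yes refl = ≤-reflexive (begin
              level v′ i                     ≡⟨ level-off i≢ ⟩
              level v i                      ≡⟨ i+1-1≡i (level v i) ⟨
              level v i + 1ℤ - 1ℤ            ≡⟨ cong (λ j → level v j + 1ℤ - 1ℤ) (i+1-1≡i i) ⟨
              level v (site - 1ℤ) + 1ℤ - 1ℤ  ≡⟨ cong (_- 1ℤ) level-left ⟩
              v site - 1ℤ                    ≡⟨ eq ⟨
              level v′ site                  ∎)
      where
      open Tight t
      open ≡-Reasoning
    ...   | no i≢ | no i+1≢ = subst₂ _≤_ (sym (level-off i≢)) (sym (level-off i+1≢)) (level-mono i)

    level-lipschitz′ : ∀ i → level v′ (i + 1ℤ) ≤ level v′ i + 1ℤ
    level-lipschitz′ i with effect inv 2≤occupancy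
    ... | unchanged eq
        = subst₂ _≤_ (sym (level-same eq (i + 1ℤ))) (cong (_+ 1ℤ) (sym (level-same eq i))) (level-lipschitz i)
    ... | lowered t eq with i ≟ site | i + 1ℤ ≟ site
    ...   | yes refl | _ = ≤-reflexive (begin
              level v′ (i + 1ℤ)   ≡⟨ level-off (i+1≢i i) ⟩
              level v (i + 1ℤ)    ≡⟨ level-right ⟩
              v i                 ≡⟨ i-1+1≡i (v i) ⟨
              v i - 1ℤ + 1ℤ       ≡⟨ cong (_+ 1ℤ) eq ⟨
              level v′ i + 1ℤ     ∎)
      where
      open Tight t
      open ≡-Reasoning
    ...   | no i≢ | yes refl = subst₂ _≤_ (sym eq)
              (trans (sym level-left) (cong (_+ 1ℤ) (trans (cong (level v) (i+1-1≡i i)) (sym (level-off i≢)))))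
              (i-j≤i (v site) 1ℤ)
      where
      open Tight t
    ...   | no i≢ | no i+1≢ = subst₂ _≤_ (sym (level-off i+1≢)) (cong (_+ 1ℤ) (sym (level-off i≢))) (level-lipschitz i)

    label≤level′ : ∀ k → label k ≤ level v′ (C′ k)
    label≤level′ k with k ≟ᶜ a | k ≟ᶜ b
    -- The strict inequality between the two labels pays for the at most 1 by which the level falls
    -- one site to the left.
    ... | yes refl | _ = subst (label a ≤_) (sym (trans (cong (level v′) a-moves) (level-off (i-1≢i site))))
            (+1-cancel-≤ (begin
              label a + 1ℤ                 ≤⟨ <⇒+1≤ a<b ⟩
              label b                      ≤⟨ label≤level b ⟩
              level v (C b)                ≡⟨ cong (level v) (trans b-at-site (sym (i-1+1≡i site))) ⟩
              level v (site - 1ℤ + 1ℤ)     ≤⟨ level-lipschitz (site - 1ℤ) ⟩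
              level v (site - 1ℤ) + 1ℤ     ∎))
      where
      open ≤-Reasoning
    ... | no _ | yes refl = begin
            label b                ≤⟨ label≤level b ⟩
            level v (C b)          ≡⟨ cong (level v) b-at-site ⟩
            level v site           ≤⟨ level-mono site ⟩
            level v (site + 1ℤ)    ≡⟨ level-off (i+1≢i site) ⟨
            level v′ (site + 1ℤ)   ≡⟨ cong (level v′) b-moves ⟨
            level v′ (C′ b)        ∎
      where
      open ≤-Reasoning
    ... | no k≢a | no k≢b = subst (label k ≤_) (sym (trans (cong (level v′) (others-stay k k≢a k≢b)) stays))
                              (label≤level k)
      where
      stays : level v′ (C k) ≡ level v (C k)
      stays with C k ≟ site | effect inv 2≤occupancy
      ... | no Ck≢site | _ = level-off Ck≢site
      ... | yes _ | unchanged eq = level-same eq (C k)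
      -- A chip staying at the fired site would be a third one there, but the level drops only at a
      -- site with exactly two.
      ... | yes Ck≡site | lowered t _ = contradiction
              (occupancy≥3 (a≢b s) (≢-sym k≢a) (≢-sym k≢b) a-at-site b-at-site Ck≡site)
              (λ 3≤occ → <⇒≱ (+<+ (ℕ.n<1+n 2)) (subst (+ 3 ≤_) (Tight.occupancy≡2 t) 3≤occ))

    -- At m the potential equals the cap, so a firing there would be tight and make the potentials
    -- at m and m + 1 equal, whereas they differ by 1.
    site<m : site < + m
    site<m = ≤∧≢⇒< (subst (_≤ + m) a-at-site (position≤m a)) λ { refl →
      i+1≢i (+ m) (trans (sym beyond) (trans (Tight.right (tight inv 2≤occupancy
        (≤-reflexive (trans right-end (sym (cap-nonneg (+≤+ ℕ.z≤n))))))) right-end)) }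

    position≤m′ : ∀ k → C′ k ≤ + m
    position≤m′ k with k ≟ᶜ a | k ≟ᶜ b
    ... | yes refl | _      = subst (_≤ + m) (sym a-moves) (≤-trans (i-j≤i site 1ℤ) (<⇒≤ site<m))
    ... | no _ | yes refl   = subst (_≤ + m) (sym b-moves) (<⇒+1≤ site<m)
    ... | no k≢a | no k≢b   = subst (_≤ + m) (sym (others-stay k k≢a k≢b)) (position≤m k)

    invariant′ : Invariant C′ v′
    invariant′ = record
      { laplacian       = fire-laplacian {v = v} s laplacian
      ; level-mono      = level-mono′
      ; level-lipschitz = level-lipschitz′
      ; label≤level     = label≤level′
      ; right-end       = trans (fire-off v (≢-sym (<⇒≢ site<m))) right-end
      ; beyond          = trans (fire-off v (≢-sym (<⇒≢ (<-trans site<m (i<i+1 (+ m)))))) beyond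
      ; left-end        = ≤-trans (fire≤ site v (- + m)) left-end
      ; position≤m      = position≤m′
      }

  -- Final positions of the positive labels

  reachable-invariant : ∀ {C} → initial m ⟶* C → ∃ (Invariant C)
  reachable-invariant = go invariant₀
    where
    go : ∀ {C C′ v} → Invariant C v → C ⟶* C′ → ∃ (Invariant C′)
    go inv ε        = _ , inv
    go inv (s ◅ ss) = go (Step.invariant′ inv s) ss

  positive-label≤position : ∀ {C v} → Invariant C v → Sparse C → ∀ k → 0ℤ < label k → label k ≤ C k
  positive-label≤position {C} {v} inv sparse k 0<k =
    -- A positive label bounded by `v (C k)` excludes the alternative that this value is at most 0.
    [ (λ v≤0 → contradiction (≤-trans k≤v v≤0) (<⇒≱ 0<k)) , ≤-trans k≤v ]′
      (Convex.below-ramp {v} convex left-end (≤-reflexive right-end) -m≤p (position≤m k))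
    where
    open Invariant inv
    k≤v : label k ≤ v (C k)
    k≤v = ≤-trans (label≤level k) (level≤ v (C k))
    convex : ∀ i → v i + v i ≤ v (i - 1ℤ) + v (i + 1ℤ)
    convex i = ≤-from (subst (_≤ 1ℤ) (laplacian i) (occupancy≤1 (sparse⇒injective {C = C} sparse) i))
                 (rearrange (v i) (v (i - 1ℤ)) (v (i + 1ℤ)))
      where
      rearrange : ∀ v l r → l + r - (v + v) ≡ 1ℤ - (1ℤ + (v + v) - l - r)
      rearrange = solve-∀
    -- The cap gives 0 < k ≤ m + C k, which places the chip in the interval where `below-ramp`
    -- applies.
    -m≤p : - + m ≤ C k
    -m≤p = ≤-from₂ (<⇒≤ 0<k)
      (≤-trans (label≤level k) (≤-trans (i⊓j≤j _ _) (+-monoʳ-≤ (+ m) (i⊓j≤i (C k) 0ℤ))))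
      (rearrange (C k) (+ m) (label k))
      where
      rearrange : ∀ p m k → p - - m ≡ (k - 0ℤ) + (m + p - k)
      rearrange = solve-∀

  -- Induction on a bound `d` for the distance from the label to m, so that larger labels are
  -- settled first.
  positive-sorted : ∀ {C} → initial m ⟶* C → Sparse C → ∀ k → 0ℤ < label k → C k ≡ label k
  positive-sorted {C} reach sparse k = descend (m ℕ.∸ ∣ label k ∣) k ℕ.≤-refl
    where
    inv = proj₂ (reachable-invariant reach)
    chipAt : ∀ {i} → 0ℤ < i → i ≤ + m → ∃ λ k → label k ≡ i
    chipAt {+[1+ n ]} _ (+≤+ n<m) = chip +[1+ n ] _ n<m , refl
    chipAt {+ zero} (+<+ ()) _
    closer : ∀ {i j} → 0ℤ < i → i < j → j ≤ + m → m ℕ.∸ ∣ j ∣ ℕ.< m ℕ.∸ ∣ i ∣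
    closer (+<+ _) (+<+ i<j) (+≤+ j≤m) = ℕ.∸-monoʳ-< i<j j≤m
    descend : ∀ d k → m ℕ.∸ ∣ label k ∣ ℕ.≤ d → 0ℤ < label k → C k ≡ label k
    descend d k bound 0<k with <-cmp (label k) (C k)
    ... | tri≈ _ eq _  = sym eq
    ... | tri> _ _ p<k = contradiction p<k (≤⇒≯ (positive-label≤position inv sparse k 0<k))
    -- Since 0 < label k < C k ≤ m, some chip `j` has label `C k`. By induction it sits at `C k` as
    -- well, and two chips would share that site.
    ... | tri< k<p _ _ with j , label-j ← chipAt (<-trans 0<k k<p) (Invariant.position≤m inv k) = blocked d bound
      where
      k<j : label k < label j
      k<j = subst (label k <_) (sym label-j) k<p
      nearer : m ℕ.∸ ∣ label j ∣ ℕ.< m ℕ.∸ ∣ label k ∣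
      nearer = closer 0<k k<j (label≤m j)
      blocked : ∀ d → m ℕ.∸ ∣ label k ∣ ℕ.≤ d → C k ≡ label k
      blocked zero    bound = contradiction (ℕ.<-≤-trans nearer bound) λ ()
      blocked (suc d) bound = contradiction
        (trans (sym label-j) (sym (descend d j (ℕ.≤-pred (ℕ.<-≤-trans nearer bound)) (<-trans 0<k k<j))))
        (sparse k j k<j)

-- Reflection

opposite : ∀ {m} → Chip m → Chip m
opposite (chip l nz bd) = chip (- l) (subst ℕ.NonZero (sym (∣-i∣≡∣i∣ l)) nz) (subst (ℕ._≤ _) (sym (∣-i∣≡∣i∣ l)) bd)

opposite-involutive : ∀ {m} (k : Chip m) → opposite (opposite k) ≡ k
opposite-involutive k = chip-≡ (neg-involutive (label k))

mirror : ∀ {m} → Config m → Config m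
mirror C k = - C (opposite k)

mirror-opposite : ∀ {m} (C : Config m) k → mirror C (opposite k) ≡ - C k
mirror-opposite C k = cong (-_ ∘ C) (opposite-involutive k)

-- Negation reverses the order of labels, so the two moving chips exchange roles.
mirror-step : ∀ {m} {C C′ : Config m} → C ⟶ C′ → mirror C ⟶ mirror C′
mirror-step {C = C} {C′} s = record
  { site        = - site
  ; a           = opposite b
  ; b           = opposite a
  ; a<b         = neg-mono-< a<b
  ; a-at-site   = trans (mirror-opposite C b) (cong -_ b-at-site)
  ; b-at-site   = trans (mirror-opposite C a) (cong -_ a-at-site)
  ; a-moves     = trans (mirror-opposite C′ b) (trans (cong -_ b-moves) (neg-distrib-+ site 1ℤ))
  ; b-moves     = trans (mirror-opposite C′ a) (trans (cong -_ a-moves) (neg-distrib-+ site (- 1ℤ)))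
  ; others-stay = λ c c≢b c≢a → cong -_ (others-stay (opposite c) (flip-≢ c≢a) (flip-≢ c≢b))
  }
  where
  open _⟶_ s
  flip-≢ : ∀ {c k} → c ≢ opposite k → opposite c ≢ k
  flip-≢ {c} c≢k eq = c≢k (trans (sym (opposite-involutive c)) (cong opposite eq))

mirror-sparse : ∀ {m} {C : Config m} → Sparse C → Sparse (mirror C)
mirror-sparse sparse a b a<b eq = sparse (opposite b) (opposite a) (neg-mono-< a<b) (sym (neg-injective eq))

theorem2p10 : ∀ (m : ℕ) → 1 ℕ.≤ m → ∀ (C : Config m) → initial m ⟶* C → Terminal C → ∀ (k : Chip m) → C k ≡ label k
theorem2p10 m _ C reach terminal k with <-cmp 0ℤ (label k)
... | tri< 0<k _ _ = positive-sorted m reach (terminal⇒sparse terminal) k 0<k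
... | tri≈ _ 0≡k _ = contradiction 0≡k (label≢0 k)
  where
  label≢0 : ∀ {m} (k : Chip m) → 0ℤ ≢ label k
  label≢0 (chip (+ zero) nz _) = ⊥-elim-irr (nz .ℕ.NonZero.nonZero)
-- `mirror (initial m)` computes to `initial m`, so the reflected run again starts from the initial
-- configuration.
... | tri> _ _ k<0 = neg-injective (trans (sym (mirror-opposite C k))
    (positive-sorted m {mirror C} (gmap mirror mirror-step reach) (mirror-sparse (terminal⇒sparse terminal))
      (opposite k) (neg-mono-< k<0)))
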